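{- Let $N\ge 2$ and $m\ge 1$ be integers and let $x^{(r,s)}_k$ ($1\le r,s\le N$, $1\le k\le m$) be elements of a commutative ring; set $x^{(r,s)}_{m+1}=0$ for all $1\le r,s\le N$. Let $D(N,m)$ be the $Nm\times Nm$ matrix which, as an $N\times N$ block matrix with $m\times m$ blocks, has $(r,s)$ block $D_m(x^{(r,s)}_1,\dots,x^{(r,s)}_m)$. Then $$\det(D(N,m))=\begin{cases}(-1)^{\frac{Nm}{2}}\prod_{i=1}^{m}\det(X_{(i,i+1)}), & \text{if } m \text{ is even},\\[2pt] (-1)^{\frac{N(m-1)}{2}}\prod_{i=1}^{m}\det(X_{(i,i+1)}), & \text{if } m \text{ is odd}.\end{cases}$$
   Context: For elements $x_1,\dots,x_m$, $D_m(x_1,\dots,x_m)$ is the $m\times m$ matrix whose $(p,q)$ entry is $x_{\max(m+1-p,\,q)}$ (bottom-left entry $x_1$, first row and last column constantly $x_m$). For $1\le i\le m$, $X_{(i,i+1)}$ is the $N\times N$ matrix whose $(r,s)$ entry is $x^{(r,s)}_i-x^{(r,s)}_{i+1}$. -}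

module Defs where

open import Algebra.Bundles using (CommutativeRing; Semiring)
import Algebra.Definitions.RawSemiring as RawSemiringDefinitions
open import Data.Fin.Base using (Fin; zero; suc; toℕ; inject₁; opposite; punchIn; quotient; remainder)
open import Data.Nat.Base as ℕ using (ℕ; zero; suc)
open import Data.Vec.Functional using (Vector; tail)

infixl 6 _⊔_

_⊔_ : ∀ {n} → Fin n → Fin n → Fin n
zero  ⊔ j     = j
suc i ⊔ zero  = suc i
suc i ⊔ suc j = suc (i ⊔ j)

module Matrices {c ℓ} (R : CommutativeRing c ℓ) where

  open CommutativeRing R hiding (zero)
  open RawSemiringDefinitions (Semiring.rawSemiring semiring) public using (sum; product; _^_)

  SquareMatrix : ℕ → Set c
  SquareMatrix n = Fin n → Fin n → Carrier

  -- The matrix obtained by deleting row 0 and column j.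
  minor : ∀ {n} → SquareMatrix (suc n) → Fin (suc n) → SquareMatrix n
  minor A j p q = A (suc p) (punchIn j q)

  -- Cofactor expansion along the first row.
  det : ∀ {n} → SquareMatrix n → Carrier
  det {zero}  A = 1#
  det {suc n} A = sum (λ j → (- 1#) ^ toℕ j * (A zero j * det (minor A j)))

  -- All indices are 0-based: the element written y₁ on paper is y zero, and
  -- opposite p is the 0-based form of the 1-based index m + 1 - p.
  D : ∀ {m} → Vector Carrier m → SquareMatrix m
  D y p q = y (opposite p ⊔ q)

  -- B r s is the (r , s) block.  For an index of Fin (N * m), quotient m is the
  -- block it lies in and remainder m its position inside that block.
  fromBlocks : ∀ {N m} → (Fin N → Fin N → SquareMatrix m) → SquareMatrix (N ℕ.* m)
  fromBlocks {N} {m} B i j =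
    B (quotient m i) (quotient m j) (remainder {N} m i) (remainder {N} m j)

  blockD : ∀ {N m} → (Fin N → Fin N → Vector Carrier m) → SquareMatrix (N ℕ.* m)
  blockD x = fromBlocks (λ r s → D (x r s))

  -- Implements the convention yₘ₊₁ = 0.
  appendZero : ∀ {m} → Vector Carrier m → Vector Carrier (suc m)
  appendZero {zero}  y _       = 0#
  appendZero {suc m} y zero    = y zero
  appendZero {suc m} y (suc i) = appendZero (tail y) i

  X : ∀ {N m} → (Fin N → Fin N → Vector Carrier m) → Fin m → SquareMatrix N
  X x i r s = appendZero (x r s) (inject₁ i) - appendZero (x r s) (suc i)

{-# OPTIONS --safe #-}
module Submission where

open import Defs
open import Algebra.Bundles using (CommutativeRing)
open import Data.Fin.Base using (Fin; zero; suc; toℕ; fromℕ; inject₁; opposite; punchIn; remQuot; combine; _<_)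
open import Data.Fin.Properties using (_≟_; suc-injective; 0≢1+n; punchInᵢ≢i; toℕ-fromℕ; toℕ-combine; remQuot-combine; combine-remQuot)
open import Data.Nat.Base as ℕ using (ℕ; zero; suc; _≥_; _∸_; _/_)
import Data.Nat.Properties as ℕ
open import Data.Nat.Divisibility using (_∣_; _∤_; divides)
open import Data.Nat.DivMod using (m*n/n≡m)
open import Data.Product.Base using (_×_; _,_; proj₁; proj₂; ∃; uncurry; swap)
open import Data.Sum.Base using (_⊎_; inj₁; inj₂)
open import Data.Vec.Functional using (Vector; _∷_; tail; updateAt; replicate)
open import Data.Vec.Functional.Properties using (updateAt-updates; updateAt-minimal)
open import Function.Base using (_∘_; const; id)
import Level
open import Relation.Binary.PropositionalEquality.Core as ≡ using (_≡_; _≢_)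
open import Relation.Nullary using (yes; no; contradiction)

-- With yₘ₊₁ = 0, an entry y_{max(a,q)} of D_m is Σ_k [a ≤ k] (y_k − y_{k+1}) [q ≤ k],
-- a = m + 1 − p.  Hence D(N,m) = (I_N ⊗ A) · W · (I_N ⊗ B), where B is unitriangular,
-- A is antitriangular with ones and W is, up to a simultaneous permutation of rows and
-- columns, block diagonal with blocks X_{(k,k+1)}.  Every alternating multilinear form f
-- satisfies f (A · v) = det A * f v; applying this block by block to the determinant, as
-- a form in the rows, takes out the N factors det A = (−1)^⌊m/2⌋ and the determinants
-- of the X_{(k,k+1)} with no permutation to keep track of.
module Determinants {c ℓ} (R : CommutativeRing c ℓ) where

  open CommutativeRing R hiding (zero)
  open Matrices R
  open import Algebra.Properties.Ring ring using (-1*x≈-x; -‿distribˡ-*; -‿distribʳ-*; -‿involutive; +-inverseˡ-unique)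
  open import Algebra.Properties.Semiring.Exp semiring using (^-congʳ; ^-congˡ; ^-assocʳ)
  open import Algebra.Properties.Semiring.Sum semiring
    using (sum-cong-≋; sum-replicate-zero; sum-remove; ∑-distrib-+; *-distribˡ-sum; *-distribʳ-sum)
  open import Algebra.Properties.CommutativeSemigroup *-commutativeSemigroup using (x∙yz≈y∙xz; interchange)
  import Algebra.Properties.Monoid.Sum *-monoid as Π
  open import Relation.Binary.Reasoning.Setoid setoid

  -- Alternating multilinear forms

  infix 4 _≋_
  _≋_ : {K : Set} → (K → Carrier) → (K → Carrier) → Set ℓ
  u ≋ v = ∀ k → u k ≈ v k

  -- The index set `I` is arbitrary so that rows can also be indexed by pairs (block, position).
  -- Linearity is stated relationally, for any `v` and `w` that agree with `u` off row `i`, so that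
  -- no decidable equality on `I` is involved. Vanishing on equal rows, rather than antisymmetry, is
  -- the right axiom over a ring in which 2 may be a zero divisor.
  record IsAlternating {I K : Set} (f : (I → K → Carrier) → Carrier) : Set (c Level.⊔ ℓ) where
    field
      cong        : ∀ {u v} → (∀ i → u i ≋ v i) → f u ≈ f v
      linear      : ∀ i a b {u v w} →
                    (∀ k → u i k ≈ a * v i k + b * w i k) →
                    (∀ j → j ≢ i → u j ≋ v j × u j ≋ w j) →
                    f u ≈ a * f v + b * f w
      alternating : ∀ {u i j} → i ≢ j → u i ≋ u j → f u ≈ 0#

  open IsAlternating

  sum-zero : ∀ {n} {t : Vector Carrier n} → (∀ i → t i ≈ 0#) → sum t ≈ 0#
  sum-zero {n} t≈0 = trans (sum-cong-≋ t≈0) (sum-replicate-zero n)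

  sum-single : ∀ {n} (i : Fin n) {t : Vector Carrier n} → (∀ j → j ≢ i → t j ≈ 0#) → sum t ≈ t i
  sum-single {suc n} i {t} t≈0 = begin
    sum t                             ≈⟨ sum-remove {i = i} t ⟩
    t i + sum (λ j → t (punchIn i j)) ≈⟨ +-congˡ (sum-zero (λ j → t≈0 _ (punchInᵢ≢i i j))) ⟩
    t i + 0#                          ≈⟨ +-identityʳ _ ⟩
    t i                               ∎

  -- Covers partial application and reindexing of the arguments: g places the
  -- j-th free argument at position h j and constants everywhere else.
  isAlternating-∘ : {I J K L : Set} {f : (I → L → Carrier) → Carrier}
    (g : (J → K → Carrier) → (I → L → Carrier)) (h : J → I) (κ : L → K) →
    (∀ {i j} → h i ≡ h j → i ≡ j) →
    (∀ u j → g u (h j) ≋ u j ∘ κ) →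
    (∀ i → (∃ λ j → i ≡ h j) ⊎ (∀ u v → g u i ≋ g v i)) →
    IsAlternating f → IsAlternating (f ∘ g)
  isAlternating-∘ {f = f} g h κ h-inj free position f-alt = record
    { cong        = λ u≋v → cong f-alt (λ i → congAt i (λ { j ≡.refl → u≋v j }))
    ; linear      = λ j a b {u} {v} {w} eq off → linear f-alt (h j) a b
        (λ k → trans (free u j k) (trans (eq (κ k))
          (sym (+-cong (*-congˡ (free v j k)) (*-congˡ (free w j k))))))
        (λ i i≢ → congAt i (λ { j′ ≡.refl → proj₁ (off j′ (λ { ≡.refl → i≢ ≡.refl })) })
                , congAt i (λ { j′ ≡.refl → proj₂ (off j′ (λ { ≡.refl → i≢ ≡.refl })) }))
    ; alternating = λ {u} {i} {j} i≢j ui≋uj → alternating f-alt (i≢j ∘ h-inj)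
        (λ k → trans (free u i k) (trans (ui≋uj (κ k)) (sym (free u j k))))
    }
    where
    congAt : ∀ i {u v} → (∀ j → i ≡ h j → u j ≋ v j) → g u i ≋ g v i
    congAt i {u} {v} u≋v k with position i
    ... | inj₁ (j , ≡.refl) = trans (free u j k) (trans (u≋v j ≡.refl (κ k)) (sym (free v j k)))
    ... | inj₂ fixed        = fixed u v k

  ∷-isAlternating : ∀ {n} {K : Set} {f : (Fin (suc n) → K → Carrier) → Carrier} →
    IsAlternating f → ∀ x → IsAlternating (λ u → f (x ∷ u))
  ∷-isAlternating f-alt x = isAlternating-∘ (x ∷_) suc id suc-injective (λ _ _ _ → refl)
    (λ { zero → inj₂ (λ _ _ _ → refl) ; (suc i) → inj₁ (i , ≡.refl) }) f-alt

  module _ {n : ℕ} {K : Set} {f : (Fin (suc n) → K → Carrier) → Carrier} (f-alt : IsAlternating f) where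

    ∷-cong : ∀ {x y u v} → x ≋ y → (∀ i → u i ≋ v i) → f (x ∷ u) ≈ f (y ∷ v)
    ∷-cong x≋y u≋v = cong f-alt (λ { zero → x≋y ; (suc i) → u≋v i })

    ∷-η : ∀ u → f u ≈ f (u zero ∷ tail u)
    ∷-η u = cong f-alt (λ { zero k → refl ; (suc i) k → refl })

    head-linear : ∀ a b x y u → f ((λ k → a * x k + b * y k) ∷ u) ≈ a * f (x ∷ u) + b * f (y ∷ u)
    head-linear a b x y u = linear f-alt zero a b (λ _ → refl)
      (λ { zero 0≢0 → contradiction ≡.refl 0≢0 ; (suc j) _ → (λ _ → refl) , (λ _ → refl) })

    head-+ : ∀ x y u → f ((λ k → x k + y k) ∷ u) ≈ f (x ∷ u) + f (y ∷ u)
    head-+ x y u = begin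
      f ((λ k → x k + y k) ∷ u)             ≈⟨ ∷-cong (λ k → +-cong (*-identityˡ _) (*-identityˡ _)) (λ _ _ → refl) ⟨
      f ((λ k → 1# * x k + 1# * y k) ∷ u)   ≈⟨ head-linear 1# 1# x y u ⟩
      1# * f (x ∷ u) + 1# * f (y ∷ u)       ≈⟨ +-cong (*-identityˡ _) (*-identityˡ _) ⟩
      f (x ∷ u) + f (y ∷ u)                 ∎

    head-sum : ∀ {p} (a : Vector Carrier p) (w : Fin p → K → Carrier) u →
      f ((λ k → sum (λ j → a j * w j k)) ∷ u) ≈ sum (λ j → a j * f (w j ∷ u))
    head-sum {zero} a w u = begin
      -- The empty combination is the zero row, rewritten as `0# * 0# + 0# * 0#` so that linearity
      -- makes the form vanish.
      f (0ᵛ ∷ u)                              ≈⟨ ∷-cong (λ k → trans (+-cong (zeroˡ 0#) (zeroˡ 0#)) (+-identityˡ 0#)) (λ _ _ → refl) ⟨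
      f ((λ _ → 0# * 0# + 0# * 0#) ∷ u)       ≈⟨ head-linear 0# 0# 0ᵛ 0ᵛ u ⟩
      0# * f (0ᵛ ∷ u) + 0# * f (0ᵛ ∷ u)       ≈⟨ +-cong (zeroˡ _) (zeroˡ _) ⟩
      0# + 0#                                 ≈⟨ +-identityˡ 0# ⟩
      0#                                      ∎
      where
      0ᵛ : K → Carrier
      0ᵛ _ = 0#
    head-sum {suc p} a w u = begin
      f ((λ k → a zero * w zero k + rest k) ∷ u)        ≈⟨ ∷-cong (λ k → +-congˡ (*-identityˡ _)) (λ _ _ → refl) ⟨
      f ((λ k → a zero * w zero k + 1# * rest k) ∷ u)   ≈⟨ head-linear _ _ _ _ u ⟩
      a zero * f (w zero ∷ u) + 1# * f (rest ∷ u)       ≈⟨ +-congˡ (*-identityˡ _) ⟩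
      a zero * f (w zero ∷ u) + f (rest ∷ u)            ≈⟨ +-congˡ (head-sum (tail a) (tail w) u) ⟩
      sum (λ j → a j * f (w j ∷ u))                     ∎
      where
      rest : K → Carrier
      rest k = sum (λ j → a (suc j) * w (suc j) k)

  -- Antisymmetry under a transposition

  swapHead : ∀ {n} {A : Set c} → Fin n → Vector A (suc n) → Vector A (suc n)
  swapHead j u = u (suc j) ∷ updateAt (tail u) j (const (u zero))

  module _ {n : ℕ} {K : Set} {f : (Fin (suc n) → K → Carrier) → Carrier} (f-alt : IsAlternating f)
    (u : Fin (suc n) → K → Carrier) (j : Fin n) where

    private
      x y : K → Carrier
      x = u zero
      y = u (suc j)

      set : (K → Carrier) → Fin n → K → Carrier
      set q = updateAt (tail u) j (const q)

      set-updates : ∀ q → set q j ≋ q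
      set-updates q k = reflexive (≡.cong (λ r → r k) (updateAt-updates j {const q} (tail u)))

      set-minimal : ∀ q i → i ≢ j → set q i ≋ u (suc i)
      set-minimal q i i≢j k = reflexive (≡.cong (λ r → r k) (updateAt-minimal i j {const q} (tail u) i≢j))

      put : (K → Carrier) → (K → Carrier) → Carrier
      put p q = f (p ∷ set q)

      put-+ : ∀ p → put p (λ k → x k + y k) ≈ put p x + put p y
      put-+ p = begin
        put p (λ k → x k + y k)       ≈⟨ linear f-alt (suc j) 1# 1# at off ⟩
        1# * put p x + 1# * put p y   ≈⟨ +-cong (*-identityˡ _) (*-identityˡ _) ⟩
        put p x + put p y             ∎
        where
        at : ∀ k → set (λ k → x k + y k) j k ≈ 1# * set x j k + 1# * set y j k
        at k = begin
          set (λ k → x k + y k) j k         ≈⟨ set-updates _ k ⟩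
          x k + y k                         ≈⟨ +-cong (set-updates x k) (set-updates y k) ⟨
          set x j k + set y j k             ≈⟨ +-cong (*-identityˡ _) (*-identityˡ _) ⟨
          1# * set x j k + 1# * set y j k   ∎

        minimal : ∀ i → suc i ≢ suc j → ∀ q r → set q i ≋ set r i
        minimal i i≢j q r k = trans (set-minimal q i (i≢j ∘ ≡.cong suc) k) (sym (set-minimal r i (i≢j ∘ ≡.cong suc) k))

        off : ∀ i → i ≢ suc j →
          (p ∷ set (λ k → x k + y k)) i ≋ (p ∷ set x) i × (p ∷ set (λ k → x k + y k)) i ≋ (p ∷ set y) i
        off zero    _   = (λ _ → refl) , (λ _ → refl)
        off (suc i) i≢j = minimal i i≢j _ x , minimal i i≢j _ y

      put-diag : ∀ p → put p p ≈ 0#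
      put-diag p = alternating f-alt {i = zero} {j = suc j} 0≢1+n (λ k → sym (set-updates p k))

      put-xy : put x y ≈ f u
      put-xy = cong f-alt eq
        where
        eq : ∀ i → (x ∷ set y) i ≋ u i
        eq zero    k = refl
        eq (suc i) k with i ≟ j
        ... | yes ≡.refl = set-updates y k
        ... | no  i≢j    = set-minimal y i i≢j k

    -- Polarization: the form vanishes when both slots hold `x + y`. Expanding by linearity in each
    -- slot, the terms `put x x` and `put y y` vanish too, which leaves `put x y + put y x ≈ 0#`.
    antisymmetric : f u ≈ - f (swapHead j u)
    antisymmetric = +-inverseˡ-unique (f u) (put y x) (begin
      f u + put y x                                   ≈⟨ +-congʳ put-xy ⟨
      put x y + put y x                               ≈⟨ +-cong (+-identityˡ _) (+-identityʳ _) ⟨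
      (0# + put x y) + (put y x + 0#)                 ≈⟨ +-cong (+-congʳ (put-diag x)) (+-congˡ (put-diag y)) ⟨
      (put x x + put x y) + (put y x + put y y)       ≈⟨ +-cong (put-+ x) (put-+ y) ⟨
      put x (λ k → x k + y k) + put y (λ k → x k + y k) ≈⟨ head-+ f-alt x y _ ⟨
      put (λ k → x k + y k) (λ k → x k + y k)         ≈⟨ put-diag _ ⟩
      0#                                              ∎)

  -- The determinant as an alternating form in its rows

  sign : ∀ {n} → Fin n → Carrier
  sign i = (- 1#) ^ toℕ i

  laplace : ∀ {n} → SquareMatrix (suc n) → Vector Carrier (suc n)
  laplace A j = sign j * (A zero j * det (minor A j))

  det-cong : ∀ {n} {A B : SquareMatrix n} → (∀ i j → A i j ≈ B i j) → det A ≈ det B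
  det-cong {zero}  A≈B = refl
  det-cong {suc n} A≈B = sum-cong-≋ (λ j → *-congˡ {sign j} (*-cong (A≈B zero j) (det-cong (λ p q → A≈B (suc p) (punchIn j q)))))

  det-linear : ∀ {n} (i : Fin n) a b {A B C : SquareMatrix n} →
    (∀ k → A i k ≈ a * B i k + b * C i k) →
    (∀ j → j ≢ i → A j ≋ B j × A j ≋ C j) →
    det A ≈ a * det B + b * det C
  det-linear {suc n} i a b {A} {B} {C} at off = begin
    det A
      ≈⟨ sum-cong-≋ (λ j → trans (*-congˡ (term i j at off)) (pull j)) ⟩
    sum (λ j → a * laplace B j + b * laplace C j)
      ≈⟨ ∑-distrib-+ (λ j → a * laplace B j) (λ j → b * laplace C j) ⟩
    sum (λ j → a * laplace B j) + sum (λ j → b * laplace C j)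
      ≈⟨ +-cong (*-distribˡ-sum a (laplace B)) (*-distribˡ-sum b (laplace C)) ⟨
    a * det B + b * det C ∎
    where
    pull : ∀ j → sign j * (a * (B zero j * det (minor B j)) + b * (C zero j * det (minor C j))) ≈ a * laplace B j + b * laplace C j
    pull j = trans (distribˡ _ _ _) (+-cong (x∙yz≈y∙xz _ _ _) (x∙yz≈y∙xz _ _ _))

    term : ∀ i j → (∀ k → A i k ≈ a * B i k + b * C i k) →
      (∀ j → j ≢ i → A j ≋ B j × A j ≋ C j) →
      A zero j * det (minor A j) ≈ a * (B zero j * det (minor B j)) + b * (C zero j * det (minor C j))
    term zero j at off = begin
      A zero j * det (minor A j)
        ≈⟨ *-congʳ (at j) ⟩
      (a * B zero j + b * C zero j) * det (minor A j)
        ≈⟨ distribʳ _ _ _ ⟩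
      a * B zero j * det (minor A j) + b * C zero j * det (minor A j)
        ≈⟨ +-cong (*-congˡ (det-cong (λ p q → proj₁ (off (suc p) (λ ())) _)))
                  (*-congˡ (det-cong (λ p q → proj₂ (off (suc p) (λ ())) _))) ⟩
      a * B zero j * det (minor B j) + b * C zero j * det (minor C j)
        ≈⟨ +-cong (*-assoc _ _ _) (*-assoc _ _ _) ⟩
      a * (B zero j * det (minor B j)) + b * (C zero j * det (minor C j)) ∎
    term (suc i) j at off = begin
      A zero j * det (minor A j)
        ≈⟨ *-congˡ (det-linear i a b (λ k → at (punchIn j k))
             (λ p p≢i → (λ q → proj₁ (off (suc p) (p≢i ∘ suc-injective)) _)
                      , (λ q → proj₂ (off (suc p) (p≢i ∘ suc-injective)) _))) ⟩
      A zero j * (a * det (minor B j) + b * det (minor C j))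
        ≈⟨ distribˡ _ _ _ ⟩
      A zero j * (a * det (minor B j)) + A zero j * (b * det (minor C j))
        ≈⟨ +-cong (x∙yz≈y∙xz _ _ _) (x∙yz≈y∙xz _ _ _) ⟩
      a * (A zero j * det (minor B j)) + b * (A zero j * det (minor C j))
        ≈⟨ +-cong (*-congˡ (*-congʳ (proj₁ (off zero (λ ())) j))) (*-congˡ (*-congʳ (proj₂ (off zero (λ ())) j))) ⟩
      a * (B zero j * det (minor B j)) + b * (C zero j * det (minor C j)) ∎

  -- Deleting column j and then the k-th remaining column removes the same two
  -- columns, in the other order, as deleting j′ and then the k′-th remaining one.
  data Twin : ∀ {n} → Fin (suc n) → Fin n → Fin (suc n) → Fin n → Set where
    base : ∀ {n} {k : Fin (suc n)} → Twin zero k (suc k) zero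
    step : ∀ {n} {j j′ : Fin (suc n)} {k k′ : Fin n} → Twin j k j′ k′ → Twin (suc j) (suc k) (suc j′) (suc k′)

  twin-punchInˡ : ∀ {n} {j j′ : Fin (suc n)} {k k′} → Twin j k j′ k′ → punchIn j k ≡ j′
  twin-punchInˡ base     = ≡.refl
  twin-punchInˡ (step t) = ≡.cong suc (twin-punchInˡ t)

  twin-punchInʳ : ∀ {n} {j j′ : Fin (suc n)} {k k′} → Twin j k j′ k′ → punchIn j′ k′ ≡ j
  twin-punchInʳ base     = ≡.refl
  twin-punchInʳ (step t) = ≡.cong suc (twin-punchInʳ t)

  twin-punchIn² : ∀ {n} {j j′ : Fin (suc (suc n))} {k k′} → Twin j k j′ k′ →
    ∀ q → punchIn j (punchIn k q) ≡ punchIn j′ (punchIn k′ q)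
  twin-punchIn² base     q       = ≡.refl
  twin-punchIn² (step t) zero    = ≡.refl
  twin-punchIn² (step t) (suc q) = ≡.cong suc (twin-punchIn² t q)

  sign-suc² : ∀ {m n} (i : Fin m) (j : Fin n) → sign (suc i) * sign (suc j) ≈ sign i * sign j
  sign-suc² i j = begin
    (- 1# * sign i) * (- 1# * sign j)   ≈⟨ *-cong (-1*x≈-x _) (-1*x≈-x _) ⟩
    - sign i * - sign j                 ≈⟨ -‿distribˡ-* _ _ ⟨
    - (sign i * - sign j)               ≈⟨ -‿cong (-‿distribʳ-* _ _) ⟨
    - - (sign i * sign j)               ≈⟨ -‿involutive _ ⟩
    sign i * sign j                     ∎

  -- The exponents `j + k` and `j′ + k′` differ by one in `base`, and `step` raises both by two.
  twin-sign : ∀ {n} {j j′ : Fin (suc n)} {k k′} → Twin j k j′ k′ → sign j′ * sign k′ ≈ - (sign j * sign k)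
  twin-sign {k = k} base = begin
    (- 1# * sign k) * 1#   ≈⟨ *-identityʳ _ ⟩
    - 1# * sign k          ≈⟨ -1*x≈-x _ ⟩
    - sign k               ≈⟨ -‿cong (*-identityˡ _) ⟨
    - (1# * sign k)        ∎
  twin-sign {j = suc j} {suc j′} {suc k} {suc k′} (step t) =
    trans (sign-suc² j′ k′) (trans (twin-sign t) (-‿cong (sym (sign-suc² j k))))

  -- The twins exhaust the double sum: `base` matches the terms `T zero k` with the terms
  -- `T (suc k) zero`, and the remaining array is again of this shape, with `step` carrying its
  -- twins over.
  twins-cancel : ∀ {n} (T : Fin (suc n) → Fin n → Carrier) →
    (∀ {j k j′ k′} → Twin j k j′ k′ → T j k + T j′ k′ ≈ 0#) → sum (λ j → sum (T j)) ≈ 0#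
  twins-cancel {zero}  T T-cancel = +-identityˡ 0#
  twins-cancel {suc n} T T-cancel = begin
    sum (T zero) + sum (λ j → T (suc j) zero + sum (λ k → T (suc j) (suc k)))
      ≈⟨ +-congˡ (∑-distrib-+ (λ j → T (suc j) zero) (λ j → sum (λ k → T (suc j) (suc k)))) ⟩
    sum (T zero) + (sum (λ j → T (suc j) zero) + sum (λ j → sum (λ k → T (suc j) (suc k))))
      ≈⟨ +-congˡ (trans (+-congˡ (twins-cancel (λ j k → T (suc j) (suc k)) (λ t → T-cancel (step t)))) (+-identityʳ _)) ⟩
    sum (T zero) + sum (λ j → T (suc j) zero)
      ≈⟨ ∑-distrib-+ (T zero) (λ j → T (suc j) zero) ⟨
    sum (λ j → T zero j + T (suc j) zero)
      ≈⟨ sum-zero (λ j → T-cancel (base {k = j})) ⟩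
    0# ∎

  rearrange₅ : ∀ s x t y d → s * (x * (t * (y * d))) ≈ (s * t) * ((x * y) * d)
  rearrange₅ s x t y d = begin
    s * (x * (t * (y * d)))   ≈⟨ *-congˡ (x∙yz≈y∙xz x t _) ⟩
    s * (t * (x * (y * d)))   ≈⟨ *-assoc _ _ _ ⟨
    (s * t) * (x * (y * d))   ≈⟨ *-congˡ (*-assoc _ _ _) ⟨
    (s * t) * ((x * y) * d)   ∎

  -- Two successive expansions give a double sum over the ordered choices of two deleted columns.
  -- Twins leave the same double minor and, the two rows being equal, the same product of entries,
  -- but they carry opposite signs.
  det-equalFirstRows : ∀ {n} (A : SquareMatrix (suc (suc n))) → A zero ≋ A (suc zero) → det A ≈ 0#
  det-equalFirstRows {n} A A₀≋A₁ = trans (sum-cong-≋ expandMinor) (twins-cancel T T-cancel)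
    where
    inner : Fin (suc (suc n)) → Fin (suc n) → Carrier
    inner j k = sign k * (A (suc zero) (punchIn j k) * det (minor (minor A j) k))

    T : Fin (suc (suc n)) → Fin (suc n) → Carrier
    T j k = sign j * (A zero j * inner j k)

    expandMinor : ∀ j → laplace A j ≈ sum (T j)
    expandMinor j = begin
      sign j * (A zero j * sum (inner j))             ≈⟨ *-congˡ (*-distribˡ-sum (A zero j) (inner j)) ⟩
      sign j * sum (λ k → A zero j * inner j k)       ≈⟨ *-distribˡ-sum (sign j) (λ k → A zero j * inner j k) ⟩
      sum (T j)                                       ∎

    T-cancel : ∀ {j k j′ k′} → Twin j k j′ k′ → T j k + T j′ k′ ≈ 0#
    T-cancel {j} {k} {j′} {k′} t = begin
      T j k + T j′ k′                     ≈⟨ +-cong (rearrange₅ _ _ _ _ _) (rearrange₅ _ _ _ _ _) ⟩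
      sign j * sign k * d + sign j′ * sign k′ * d′ ≈⟨ +-congˡ (*-cong (twin-sign t) d′≈d) ⟩
      sign j * sign k * d + - (sign j * sign k) * d ≈⟨ distribʳ _ _ _ ⟨
      (sign j * sign k + - (sign j * sign k)) * d ≈⟨ *-congʳ (-‿inverseʳ _) ⟩
      0# * d                              ≈⟨ zeroˡ _ ⟩
      0#                                  ∎
      where
      d d′ : Carrier
      d  = (A zero j * A (suc zero) (punchIn j k)) * det (minor (minor A j) k)
      d′ = (A zero j′ * A (suc zero) (punchIn j′ k′)) * det (minor (minor A j′) k′)

      -- Passing to the twin exchanges the two columns, so each entry reappears in the other of the
      -- two equal rows; commutativity restores the order.
      d′≈d : d′ ≈ d
      d′≈d = *-cong
        (trans (*-comm _ _) (*-cong
          (trans (reflexive (≡.cong (A (suc zero)) (twin-punchInʳ t))) (sym (A₀≋A₁ j)))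
          (trans (A₀≋A₁ j′) (reflexive (≡.cong (A (suc zero)) (≡.sym (twin-punchInˡ t)))))))
        (det-cong (λ p q → reflexive (≡.cong (A (suc (suc p))) (≡.sym (twin-punchIn² t q)))))

  det-minors-zero : ∀ {n} (A : SquareMatrix (suc n)) → (∀ j → det (minor A j) ≈ 0#) → det A ≈ 0#
  det-minors-zero A minors≈0 = sum-zero {t = laplace A} (λ j → trans (*-congˡ (trans (*-congˡ (minors≈0 j)) (zeroʳ _))) (zeroʳ _))

  -- Reduction to equality of the first two rows: `A′` exchanges row 1 with the row equal to row 0.
  -- Row 0 is untouched, so every minor of the expansion undergoes one transposition and changes
  -- sign by antisymmetry in the smaller size.
  det-alternating-head : ∀ {n} → IsAlternating (det {n}) →
    (A : SquareMatrix (suc n)) (j : Fin n) → A zero ≋ A (suc j) → det A ≈ 0#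
  det-alternating-head d-alt A zero    A₀≋Aⱼ = det-equalFirstRows A A₀≋Aⱼ
  det-alternating-head d-alt A (suc j) A₀≋Aⱼ = begin
    det A                                             ≈⟨ sum-cong-≋ swapMinor ⟩
    sum (λ q → - 1# * laplace A′ q)                    ≈⟨ *-distribˡ-sum (- 1#) (laplace A′) ⟨
    - 1# * det A′                                     ≈⟨ *-congˡ (det-equalFirstRows A′ A₀≋Aⱼ) ⟩
    - 1# * 0#                                         ≈⟨ zeroʳ _ ⟩
    0#                                                ∎
    where
    A′ : SquareMatrix _
    A′ = A zero ∷ swapHead j (tail A)

    minor-swap : ∀ q i → swapHead j (minor A q) i ≋ minor A′ q i
    minor-swap q zero    k = refl
    minor-swap q (suc i) k with i ≟ j
    ... | yes ≡.refl = reflexive (≡.trans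
      (≡.cong (λ r → r k) (updateAt-updates j (tail (minor A q))))
      (≡.cong (λ r → r (punchIn q k)) (≡.sym (updateAt-updates j {const (A (suc zero))} (tail (tail A))))))
    ... | no i≢j = reflexive (≡.trans
      (≡.cong (λ r → r k) (updateAt-minimal i j (tail (minor A q)) i≢j))
      (≡.cong (λ r → r (punchIn q k)) (≡.sym (updateAt-minimal i j {const (A (suc zero))} (tail (tail A)) i≢j))))

    swapMinor : ∀ q → laplace A q ≈ - 1# * laplace A′ q
    swapMinor q = begin
      sign q * (A zero q * det (minor A q))
        ≈⟨ *-congˡ (*-congˡ (trans (antisymmetric d-alt (minor A q) j) (-‿cong (det-cong (minor-swap q))))) ⟩
      sign q * (A zero q * - det (minor A′ q))
        ≈⟨ *-congˡ (*-congˡ (-1*x≈-x _)) ⟨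
      sign q * (A zero q * (- 1# * det (minor A′ q)))
        ≈⟨ *-congˡ (x∙yz≈y∙xz _ _ _) ⟩
      sign q * (- 1# * (A zero q * det (minor A′ q)))
        ≈⟨ x∙yz≈y∙xz _ _ _ ⟩
      - 1# * (sign q * (A zero q * det (minor A′ q))) ∎

  det-isAlternating : ∀ n → IsAlternating (det {n})
  det-isAlternating zero = record
    { cong = λ _ → refl ; linear = λ () ; alternating = λ { {i = ()} } }
  det-isAlternating (suc n) = record
    { cong        = det-cong
    ; linear      = λ i a b → det-linear i a b
    ; alternating = alt
    }
    where
    alt : ∀ {A : SquareMatrix (suc n)} {i j} → i ≢ j → A i ≋ A j → det A ≈ 0#
    alt {A} {zero}  {zero}  i≢j _     = contradiction ≡.refl i≢j
    alt {A} {zero}  {suc j} _   Aᵢ≋Aⱼ = det-alternating-head (det-isAlternating n) A j Aᵢ≋Aⱼ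
    alt {A} {suc i} {zero}  _   Aᵢ≋Aⱼ = det-alternating-head (det-isAlternating n) A i (λ k → sym (Aᵢ≋Aⱼ k))
    -- Neither row is the one expanded along, so both survive, still equal, in every minor.
    alt {A} {suc i} {suc j} i≢j Aᵢ≋Aⱼ = det-minors-zero A
      (λ q → alternating (det-isAlternating n) (i≢j ∘ ≡.cong suc) (λ k → Aᵢ≋Aⱼ (punchIn q k)))

  -- Taking a matrix out of an alternating form

  -- One transposition brings `v zero` back to the front; with it frozen, induction puts `v (suc j)`
  -- in its place within the tail. This makes `j` transpositions in all.
  moveToFront : ∀ {n} {K : Set} {f : (Fin (suc n) → K → Carrier) → Carrier} → IsAlternating f →
    ∀ j v → f (v j ∷ (v ∘ punchIn j)) ≈ sign j * f v
  moveToFront f-alt zero v = trans (sym (∷-η f-alt v)) (sym (*-identityˡ _))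
  moveToFront {suc n} {f = f} f-alt (suc j) v = begin
    f (v (suc j) ∷ (v ∘ punchIn (suc j)))
      ≈⟨ antisymmetric f-alt _ zero ⟩
    - f (swapHead zero (v (suc j) ∷ (v ∘ punchIn (suc j))))
      ≈⟨ -‿cong (cong f-alt (λ { zero _ → refl ; (suc zero) _ → refl ; (suc (suc i)) _ → refl })) ⟩
    - f (v zero ∷ (v (suc j) ∷ (v ∘ suc ∘ punchIn j)))
      ≈⟨ -‿cong (moveToFront (∷-isAlternating f-alt (v zero)) j (tail v)) ⟩
    - (sign j * f (v zero ∷ tail v))
      ≈⟨ -1*x≈-x _ ⟨
    - 1# * (sign j * f (v zero ∷ tail v))
      ≈⟨ *-assoc _ _ _ ⟨
    sign (suc j) * f (v zero ∷ tail v)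
      ≈⟨ *-congˡ (∷-η f-alt v) ⟨
    sign (suc j) * f v ∎

  -- Row operations, cleared one row at a time. The vector `x` is not itself a row of `f`: the
  -- intended `f` is a larger form with `x` frozen as its first row, which vanishes as soon as
  -- another row equals `x`.
  dropMultiples : ∀ {n} {K : Set} {f : (Fin n → K → Carrier) → Carrier} → IsAlternating f →
    (x : K → Carrier) → (∀ u i → u i ≋ x → f u ≈ 0#) →
    ∀ (a : Vector Carrier n) w → f (λ i k → a i * x k + w i k) ≈ f w
  dropMultiples {zero} f-alt x fx≈0 a w = cong f-alt (λ ())
  dropMultiples {suc n} {f = f} f-alt x fx≈0 a w = begin
    f (λ i k → a i * x k + w i k)
      ≈⟨ ∷-η f-alt _ ⟩
    f ((λ k → a zero * x k + w zero k) ∷ u)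
      ≈⟨ ∷-cong f-alt (λ k → +-congˡ (*-identityˡ _)) (λ _ _ → refl) ⟨
    f ((λ k → a zero * x k + 1# * w zero k) ∷ u)
      ≈⟨ head-linear f-alt _ _ _ _ u ⟩
    a zero * f (x ∷ u) + 1# * f (w zero ∷ u)
      ≈⟨ +-cong (trans (*-congˡ (fx≈0 _ zero (λ _ → refl))) (zeroʳ _)) (*-identityˡ _) ⟩
    0# + f (w zero ∷ u)
      ≈⟨ +-identityˡ _ ⟩
    f (w zero ∷ u)
      ≈⟨ dropMultiples (∷-isAlternating f-alt (w zero)) x (λ v i vᵢ≋x → fx≈0 _ (suc i) vᵢ≋x) (tail a) (tail w) ⟩
    f (w zero ∷ tail w)
      ≈⟨ ∷-η f-alt w ⟨
    f w ∎
    where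
    u : Fin n → _ → Carrier
    u i k = a (suc i) * x k + w (suc i) k

  infixr 7 _·_
  _·_ : ∀ {n} {K : Set} → SquareMatrix n → (Fin n → K → Carrier) → (Fin n → K → Carrier)
  (A · v) i k = sum (λ j → A i j * v j k)

  -- Linearity in the first row produces the sum over `j` with `v j` in front. The multiples of
  -- `v j` in the later rows then drop out, so that only `minor A j` acts on the other rows.
  -- Induction yields its determinant and `moveToFront` the sign, which together form the Laplace
  -- expansion of `det A`.
  alternating-· : ∀ {n} {K : Set} {f : (Fin n → K → Carrier) → Carrier} → IsAlternating f →
    ∀ (A : SquareMatrix n) v → f (A · v) ≈ det A * f v
  alternating-· {zero}  f-alt A v = trans (cong f-alt (λ ())) (sym (*-identityˡ _))
  alternating-· {suc n} {f = f} f-alt A v = begin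
    f (A · v)
      ≈⟨ ∷-η f-alt _ ⟩
    f ((A · v) zero ∷ tail (A · v))
      ≈⟨ head-sum f-alt (A zero) v _ ⟩
    sum (λ j → A zero j * f (v j ∷ tail (A · v)))
      ≈⟨ sum-cong-≋ term ⟩
    sum (λ j → laplace A j * f v)
      ≈⟨ *-distribʳ-sum (f v) (laplace A) ⟨
    det A * f v ∎
    where
    cofactor : ∀ j → f (v j ∷ tail (A · v)) ≈ det (minor A j) * (sign j * f v)
    cofactor j = begin
      f (v j ∷ tail (A · v))
        ≈⟨ ∷-cong f-alt (λ _ → refl) (λ i k → sum-remove {i = j} (λ l → A (suc i) l * v l k)) ⟩
      f (v j ∷ (λ i k → A (suc i) j * v j k + (minor A j · (v ∘ punchIn j)) i k))
        ≈⟨ dropMultiples g-alt (v j) (λ u i uᵢ≋vⱼ → alternating f-alt {i = zero} {j = suc i} 0≢1+n (λ k → sym (uᵢ≋vⱼ k))) _ _ ⟩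
      f (v j ∷ (minor A j · (v ∘ punchIn j)))
        ≈⟨ alternating-· g-alt (minor A j) (v ∘ punchIn j) ⟩
      det (minor A j) * f (v j ∷ (v ∘ punchIn j))
        ≈⟨ *-congˡ (moveToFront f-alt j v) ⟩
      det (minor A j) * (sign j * f v) ∎
      where
      g-alt : IsAlternating (λ u → f (v j ∷ u))
      g-alt = ∷-isAlternating f-alt (v j)

    term : ∀ j → A zero j * f (v j ∷ tail (A · v)) ≈ laplace A j * f v
    term j = begin
      A zero j * f (v j ∷ tail (A · v))                 ≈⟨ *-congˡ (cofactor j) ⟩
      A zero j * (det (minor A j) * (sign j * f v))     ≈⟨ *-assoc _ _ _ ⟨
      (A zero j * det (minor A j)) * (sign j * f v)     ≈⟨ x∙yz≈y∙xz _ _ _ ⟩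
      sign j * ((A zero j * det (minor A j)) * f v)     ≈⟨ *-assoc _ _ _ ⟨
      laplace A j * f v                                 ∎

  -- Taking out block diagonal matrices

  module _ {a b : ℕ} {K : Set} where

    consBlock : (Fin b → K → Carrier) → (Fin a × Fin b → K → Carrier) → (Fin (suc a) × Fin b → K → Carrier)
    consBlock u w (zero  , r) = u r
    consBlock u w (suc l , r) = w (l , r)

    headBlock-isAlternating : {f : (Fin (suc a) × Fin b → K → Carrier) → Carrier} →
      IsAlternating f → ∀ w → IsAlternating (λ u → f (consBlock u w))
    headBlock-isAlternating f-alt w = isAlternating-∘ (λ u → consBlock u w) (zero ,_) id
      (λ { ≡.refl → ≡.refl }) (λ _ _ _ → refl)
      (λ { (zero , r) → inj₁ (r , ≡.refl) ; (suc l , r) → inj₂ (λ _ _ _ → refl) }) f-alt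

    tailBlocks-isAlternating : {f : (Fin (suc a) × Fin b → K → Carrier) → Carrier} →
      IsAlternating f → ∀ u → IsAlternating (λ w → f (consBlock u w))
    tailBlocks-isAlternating f-alt u = isAlternating-∘ (consBlock u) (λ { (l , r) → suc l , r }) id
      (λ { ≡.refl → ≡.refl }) (λ _ _ _ → refl)
      (λ { (zero , r) → inj₂ (λ _ _ _ → refl) ; (suc l , r) → inj₁ ((l , r) , ≡.refl) }) f-alt

  infixr 7 _⊡_
  -- Left multiplication by the block diagonal matrix with diagonal blocks `X l`.
  _⊡_ : ∀ {a b} {K : Set} → (Fin a → SquareMatrix b) → (Fin a × Fin b → K → Carrier) → (Fin a × Fin b → K → Carrier)
  (X ⊡ v) (l , r) = (X l · (λ s → v (l , s))) r

  -- With all other blocks of rows frozen, `f` is an alternating form in the rows of one block, so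
  -- `alternating-·` applies to the blocks one after another.
  alternating-⊡ : ∀ {a b} {K : Set} {f : (Fin a × Fin b → K → Carrier) → Carrier} → IsAlternating f →
    ∀ (X : Fin a → SquareMatrix b) v → f (X ⊡ v) ≈ product (λ l → det (X l)) * f v
  alternating-⊡ {zero}  f-alt X v = trans (cong f-alt (λ { (() , _) })) (sym (*-identityˡ _))
  alternating-⊡ {suc a} {f = f} f-alt X v = begin
    f (X ⊡ v)
      ≈⟨ cong f-alt (λ { (zero , r) _ → refl ; (suc l , r) _ → refl }) ⟩
    f (consBlock (X zero · v₀) (tail X ⊡ v₊))
      ≈⟨ alternating-· (headBlock-isAlternating f-alt _) (X zero) v₀ ⟩
    det (X zero) * f (consBlock v₀ (tail X ⊡ v₊))
      ≈⟨ *-congˡ (alternating-⊡ (tailBlocks-isAlternating f-alt v₀) (tail X) v₊) ⟩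
    det (X zero) * (product (λ l → det (X (suc l))) * f (consBlock v₀ v₊))
      ≈⟨ *-assoc _ _ _ ⟨
    product (λ l → det (X l)) * f (consBlock v₀ v₊)
      ≈⟨ *-congˡ (cong f-alt (λ { (zero , r) _ → refl ; (suc l , r) _ → refl })) ⟩
    product (λ l → det (X l)) * f v ∎
    where
    v₀ = λ r → v (zero , r)
    v₊ = λ (l , r) → v (suc l , r)

  -- Unitriangular determinants and indicator matrices

  det-firstRow-single : ∀ {n} (A : SquareMatrix (suc n)) i → (∀ j → j ≢ i → A zero j ≈ 0#) → det A ≈ laplace A i
  det-firstRow-single A i A₀≈0 = sum-single i {laplace A}
    (λ j j≢i → trans (*-congˡ (trans (*-congʳ (A₀≈0 j j≢i)) (zeroˡ _))) (zeroʳ _))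

  det-unitriangular : ∀ {n} {A : SquareMatrix n} →
    (∀ i → A i i ≈ 1#) → (∀ {i j} → i < j → A i j ≈ 0#) → det A ≈ 1#
  det-unitriangular {zero}      diag above = refl
  det-unitriangular {suc n} {A} diag above = begin
    det A
      ≈⟨ det-firstRow-single A zero (λ { zero 0≢0 → contradiction ≡.refl 0≢0 ; (suc j) _ → above ℕ.z<s }) ⟩
    1# * (A zero zero * det (minor A zero))
      ≈⟨ *-identityˡ _ ⟩
    A zero zero * det (minor A zero)
      ≈⟨ *-cong (diag zero) (det-unitriangular (λ i → diag (suc i)) (λ i<j → above (ℕ.s<s i<j))) ⟩
    1# * 1#
      ≈⟨ *-identityˡ _ ⟩
    1# ∎

  𝟙≤ : ∀ {m} → Fin m → Fin m → Carrier
  𝟙≤ zero    j       = 1#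
  𝟙≤ (suc i) zero    = 0#
  𝟙≤ (suc i) (suc j) = 𝟙≤ i j

  𝟙≤-refl : ∀ {m} (i : Fin m) → 𝟙≤ i i ≈ 1#
  𝟙≤-refl zero    = refl
  𝟙≤-refl (suc i) = 𝟙≤-refl i

  𝟙≤-> : ∀ {m} {i j : Fin m} → j < i → 𝟙≤ i j ≈ 0#
  𝟙≤-> {i = suc i} {zero}  _           = refl
  𝟙≤-> {i = suc i} {suc j} (ℕ.s≤s j<i) = 𝟙≤-> j<i

  -- The universal property of the maximum. It is the source of the index `opposite p ⊔ q` in `D`.
  𝟙≤-⊔ : ∀ {m} (i j k : Fin m) → 𝟙≤ i k * 𝟙≤ j k ≈ 𝟙≤ (i ⊔ j) k
  𝟙≤-⊔ zero    j       k       = *-identityˡ _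
  𝟙≤-⊔ (suc i) zero    k       = *-identityʳ _
  𝟙≤-⊔ (suc i) (suc j) zero    = zeroˡ _
  𝟙≤-⊔ (suc i) (suc j) (suc k) = 𝟙≤-⊔ i j k

  𝟙≤-inject₁ : ∀ {m} (i j : Fin m) → 𝟙≤ (inject₁ i) (inject₁ j) ≡ 𝟙≤ i j
  𝟙≤-inject₁ zero    j       = ≡.refl
  𝟙≤-inject₁ (suc i) zero    = ≡.refl
  𝟙≤-inject₁ (suc i) (suc j) = 𝟙≤-inject₁ i j

  𝟙≤-fromℕ : ∀ m (j : Fin (suc m)) → j ≢ fromℕ m → 𝟙≤ (fromℕ m) j ≈ 0#
  𝟙≤-fromℕ zero    zero    0≢0 = contradiction ≡.refl 0≢0
  𝟙≤-fromℕ (suc m) zero    _   = refl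
  𝟙≤-fromℕ (suc m) (suc j) j≢m = 𝟙≤-fromℕ m j (j≢m ∘ ≡.cong suc)

  δ : ∀ {N} → Fin N → Fin N → Carrier
  δ zero    zero    = 1#
  δ zero    (suc s) = 0#
  δ (suc r) zero    = 0#
  δ (suc r) (suc s) = δ r s

  δ-refl : ∀ {N} (r : Fin N) → δ r r ≈ 1#
  δ-refl zero    = refl
  δ-refl (suc r) = δ-refl r

  δ-≢ : ∀ {N} {r s : Fin N} → r ≢ s → δ r s ≈ 0#
  δ-≢ {r = zero}  {zero}  r≢s = contradiction ≡.refl r≢s
  δ-≢ {r = zero}  {suc s} _   = refl
  δ-≢ {r = suc r} {zero}  _   = refl
  δ-≢ {r = suc r} {suc s} r≢s = δ-≢ (r≢s ∘ ≡.cong suc)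

  -- Telescoping sums

  -- Chosen so that `differences (x r s) k` is definitionally `X x k r s`.
  differences : ∀ {m} → Vector Carrier m → Vector Carrier m
  differences y k = appendZero y (inject₁ k) - appendZero y (suc k)

  sum-differences : ∀ {m} (y : Vector Carrier m) → sum (differences y) ≈ appendZero y zero
  sum-differences {zero}  y = refl
  sum-differences {suc m} y = begin
    (y zero - appendZero (tail y) zero) + sum (differences (tail y)) ≈⟨ +-congˡ (sum-differences (tail y)) ⟩
    (y zero - appendZero (tail y) zero) + appendZero (tail y) zero   ≈⟨ +-assoc _ _ _ ⟩
    y zero + (- appendZero (tail y) zero + appendZero (tail y) zero) ≈⟨ +-congˡ (-‿inverseˡ _) ⟩
    y zero + 0#                                                      ≈⟨ +-identityʳ _ ⟩
    y zero                                                           ∎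

  -- The indicator discards the differences before `i`; the rest telescope from `y i` down to the
  -- appended zero.
  telescope : ∀ {m} (y : Vector Carrier m) i → sum (λ k → 𝟙≤ i k * differences y k) ≈ y i
  telescope y zero    = trans (sum-cong-≋ (λ k → *-identityˡ (differences y k))) (sum-differences y)
  telescope y (suc i) = begin
    0# * differences y zero + sum (λ k → 𝟙≤ i k * differences (tail y) k) ≈⟨ +-cong (zeroˡ _) (telescope (tail y) i) ⟩
    0# + y (suc i)                                                        ≈⟨ +-identityˡ _ ⟩
    y (suc i)                                                             ∎

  -- The determinant of the antitriangular factor

  -- Ones on and below the antidiagonal, zeros above it.
  antitriangle : ∀ {m} → SquareMatrix m
  antitriangle p i = 𝟙≤ (opposite p) i

  punchIn-fromℕ : ∀ {m} (q : Fin m) → punchIn (fromℕ m) q ≡ inject₁ q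
  punchIn-fromℕ zero    = ≡.refl
  punchIn-fromℕ (suc q) = ≡.cong suc (punchIn-fromℕ q)

  -- The first row has its only nonzero entry in the last column, 0-based index `m`; deleting both
  -- leaves the antitriangle of size `m`.
  det-antitriangle-suc : ∀ m → det (antitriangle {suc m}) ≈ (- 1#) ^ m * det (antitriangle {m})
  det-antitriangle-suc m = begin
    det (antitriangle {suc m})
      ≈⟨ det-firstRow-single (antitriangle {suc m}) (fromℕ m) (𝟙≤-fromℕ m) ⟩
    sign (fromℕ m) * (𝟙≤ (fromℕ m) (fromℕ m) * det (minor (antitriangle {suc m}) (fromℕ m)))
      ≈⟨ *-cong (^-congʳ (- 1#) (toℕ-fromℕ m)) (trans (*-congʳ (𝟙≤-refl (fromℕ m))) (*-identityˡ _)) ⟩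
    (- 1#) ^ m * det (minor (antitriangle {suc m}) (fromℕ m))
      ≈⟨ *-congˡ (det-cong {m} (λ p q → reflexive (≡.trans
           (≡.cong (𝟙≤ (inject₁ (opposite p))) (punchIn-fromℕ q)) (𝟙≤-inject₁ (opposite p) q)))) ⟩
    (- 1#) ^ m * det (antitriangle {m}) ∎

  [-1]^n*[-1]^n≈1 : ∀ n → (- 1#) ^ n * (- 1#) ^ n ≈ 1#
  [-1]^n*[-1]^n≈1 zero    = *-identityˡ _
  [-1]^n*[-1]^n≈1 (suc n) = begin
    (- 1# * (- 1#) ^ n) * (- 1# * (- 1#) ^ n)   ≈⟨ interchange _ _ _ _ ⟩
    (- 1# * - 1#) * ((- 1#) ^ n * (- 1#) ^ n)   ≈⟨ *-cong (trans (-1*x≈-x _) (-‿involutive 1#)) ([-1]^n*[-1]^n≈1 n) ⟩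
    1# * 1#                                     ≈⟨ *-identityˡ _ ⟩
    1#                                          ∎

  -- Two consecutive expansions contribute exponents `m + 1` and `m`, whose sum is odd whatever `m`
  -- is.
  det-antitriangle-suc² : ∀ m → det (antitriangle {suc (suc m)}) ≈ - 1# * det (antitriangle {m})
  det-antitriangle-suc² m = begin
    det (antitriangle {suc (suc m)})
      ≈⟨ trans (det-antitriangle-suc (suc m)) (*-congˡ (det-antitriangle-suc m)) ⟩
    (- 1# * (- 1#) ^ m) * ((- 1#) ^ m * det (antitriangle {m}))
      ≈⟨ trans (*-assoc _ _ _) (*-congˡ (sym (*-assoc _ _ _))) ⟩
    - 1# * (((- 1#) ^ m * (- 1#) ^ m) * det (antitriangle {m}))
      ≈⟨ *-congˡ (trans (*-congʳ ([-1]^n*[-1]^n≈1 m)) (*-identityˡ _)) ⟩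
    - 1# * det (antitriangle {m}) ∎

  det-antitriangle-even : ∀ k → det (antitriangle {k ℕ.* 2}) ≈ (- 1#) ^ k
  det-antitriangle-even zero    = refl
  det-antitriangle-even (suc k) = trans (det-antitriangle-suc² (k ℕ.* 2)) (*-congˡ (det-antitriangle-even k))

  det-antitriangle-odd : ∀ k → det (antitriangle {suc (k ℕ.* 2)}) ≈ (- 1#) ^ k
  det-antitriangle-odd zero    = trans (det-antitriangle-suc 0) (*-identityˡ _)
  det-antitriangle-odd (suc k) = trans (det-antitriangle-suc² (suc (k ℕ.* 2))) (*-congˡ (det-antitriangle-odd k))

  -- Factorization of the block matrix

  module _ (N m : ℕ) where

    pairDet : (Fin N × Fin m → Fin N × Fin m → Carrier) → Carrier
    pairDet u = det (λ i j → u (remQuot m i) (remQuot m j))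

    pairDet-isAlternating : IsAlternating pairDet
    pairDet-isAlternating = isAlternating-∘ (λ u i j → u (remQuot m i) (remQuot m j)) (uncurry combine) (remQuot m)
      (λ {p} {q} eq → ≡.trans (≡.sym (remQuot-combine (proj₁ p) (proj₂ p)))
                        (≡.trans (≡.cong (remQuot m) eq) (remQuot-combine (proj₁ q) (proj₂ q))))
      (λ u p k → reflexive (≡.cong (λ p → u p (remQuot m k)) (remQuot-combine (proj₁ p) (proj₂ p))))
      (λ i → inj₁ (remQuot m i , ≡.sym (combine-remQuot {N} m i)))
      (det-isAlternating (N ℕ.* m))

    -- Lets rows be grouped by their position inside a block, the grouping in which the middle
    -- factor is block diagonal. Being alternating does not depend on how rows are labelled, so no
    -- permutation sign appears.
    pairDet-swap-isAlternating : IsAlternating (λ u → pairDet (u ∘ swap))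
    pairDet-swap-isAlternating = isAlternating-∘ (_∘ swap) swap id
      (λ { ≡.refl → ≡.refl }) (λ _ _ _ → refl) (λ p → inj₁ (swap p , ≡.refl)) pairDet-isAlternating

    -- The Kronecker product of the identity of size `N` with the lower unitriangular matrix of
    -- ones.
    triangle : Fin N × Fin m → Fin N × Fin m → Carrier
    triangle (r , i) (s , q) = δ r s * 𝟙≤ q i

    -- An index equals `m` times its quotient plus its remainder, and equal quotients cancel.
    remainder-< : ∀ {i j : Fin (N ℕ.* m)} → i < j → proj₁ (remQuot {N} m i) ≡ proj₁ (remQuot {N} m j) →
      proj₂ (remQuot {N} m i) < proj₂ (remQuot {N} m j)
    remainder-< {i} {j} i<j quot≡ = ℕ.+-cancelˡ-< _ _ _
      (≡.subst₂ ℕ._<_ (position i) (≡.trans (position j) (≡.cong (λ r → m ℕ.* toℕ r ℕ.+ _) (≡.sym quot≡))) i<j)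
      where
      position : ∀ i → toℕ i ≡ m ℕ.* toℕ (proj₁ (remQuot {N} m i)) ℕ.+ toℕ (proj₂ (remQuot {N} m i))
      position i = ≡.trans (≡.cong toℕ (≡.sym (combine-remQuot {N} m i))) (toℕ-combine (proj₁ (remQuot {N} m i)) (proj₂ (remQuot {N} m i)))

    pairDet-triangle : pairDet triangle ≈ 1#
    pairDet-triangle = det-unitriangular
      (λ i → trans (*-cong (δ-refl (proj₁ (remQuot {N} m i))) (𝟙≤-refl (proj₂ (remQuot {N} m i)))) (*-identityˡ _))
      above
      where
      above : ∀ {i j} → i < j → triangle (remQuot m i) (remQuot m j) ≈ 0#
      above {i} {j} i<j with proj₁ (remQuot {N} m i) ≟ proj₁ (remQuot {N} m j)
      ... | yes quot≡ = trans (*-congˡ (𝟙≤-> (remainder-< i<j quot≡))) (zeroʳ _)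
      ... | no  quot≢ = trans (*-congʳ (δ-≢ quot≢)) (zeroˡ _)

    module _ (x : Fin N → Fin N → Vector Carrier m) where

      -- The inner `swap` groups rows by position for the blocks `X x k`, the outer one returns to
      -- the grouping by block for the antitriangles. In each entry `δ` selects one block, `𝟙≤-⊔`
      -- merges the two indicators and `telescope` evaluates the sum.
      factorization : ∀ p q →
        (const antitriangle ⊡ ((X x ⊡ (triangle ∘ swap)) ∘ swap)) p q
          ≈ D (x (proj₁ p) (proj₁ q)) (proj₂ p) (proj₂ q)
      factorization (r , p) (s , q) = trans (sum-cong-≋ term) (telescope (x r s) (opposite p ⊔ q))
        where
        selectBlock : ∀ k → sum (λ t → X x k r t * (δ t s * 𝟙≤ q k)) ≈ X x k r s * 𝟙≤ q k
        selectBlock k = begin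
          sum (λ t → X x k r t * (δ t s * 𝟙≤ q k))
            ≈⟨ sum-single s (λ t t≢s → trans (*-congˡ (trans (*-congʳ (δ-≢ t≢s)) (zeroˡ _))) (zeroʳ _)) ⟩
          X x k r s * (δ s s * 𝟙≤ q k)
            ≈⟨ *-congˡ (trans (*-congʳ (δ-refl s)) (*-identityˡ _)) ⟩
          X x k r s * 𝟙≤ q k ∎

        term : ∀ k → 𝟙≤ (opposite p) k * sum (λ t → X x k r t * (δ t s * 𝟙≤ q k))
                   ≈ 𝟙≤ (opposite p ⊔ q) k * differences (x r s) k
        term k = begin
          𝟙≤ (opposite p) k * sum (λ t → X x k r t * (δ t s * 𝟙≤ q k)) ≈⟨ *-congˡ (trans (selectBlock k) (*-comm _ _)) ⟩
          𝟙≤ (opposite p) k * (𝟙≤ q k * X x k r s)                     ≈⟨ *-assoc _ _ _ ⟨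
          (𝟙≤ (opposite p) k * 𝟙≤ q k) * X x k r s                     ≈⟨ *-congʳ (𝟙≤-⊔ (opposite p) q k) ⟩
          𝟙≤ (opposite p ⊔ q) k * X x k r s                            ∎

      det-blockD : det (blockD x) ≈ det (antitriangle {m}) ^ N * product (λ i → det (X x i))
      det-blockD = begin
        det (blockD x)
          ≈⟨ det-cong (λ i j → factorization (remQuot m i) (remQuot m j)) ⟨
        pairDet (const antitriangle ⊡ ((X x ⊡ (triangle ∘ swap)) ∘ swap))
          ≈⟨ alternating-⊡ pairDet-isAlternating (const antitriangle) ((X x ⊡ (triangle ∘ swap)) ∘ swap) ⟩
        product (replicate N (det (antitriangle {m}))) * pairDet ((X x ⊡ (triangle ∘ swap)) ∘ swap)
          -- The remaining determinant is now read as a form in the rows grouped by position, from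
          -- which the blocks `X x k` come out.
          ≈⟨ *-cong (Π.sum-replicate N) (alternating-⊡ pairDet-swap-isAlternating (X x) (triangle ∘ swap)) ⟩
        det (antitriangle {m}) ^ N * (product (λ i → det (X x i)) * pairDet triangle)
          ≈⟨ *-congˡ (trans (*-congˡ pairDet-triangle) (*-identityʳ _)) ⟩
        det (antitriangle {m}) ^ N * product (λ i → det (X x i)) ∎

  -- Parity of `m` and the exponent of the sign

  -- Serves both parities: `k * 2` is `m` in the even case and `m ∸ 1` in the odd one, so the
  -- division by 2 is exact.
  sign-power : ∀ N k {a} → a ≈ (- 1#) ^ k → a ^ N ≈ (- 1#) ^ ((N ℕ.* (k ℕ.* 2)) / 2)
  sign-power N k {a} a≈ = begin
    a ^ N                                ≈⟨ ^-congˡ N a≈ ⟩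
    ((- 1#) ^ k) ^ N                     ≈⟨ ^-assocʳ (- 1#) k N ⟩
    (- 1#) ^ (k ℕ.* N)                   ≈⟨ ^-congʳ (- 1#) exponent ⟩
    (- 1#) ^ ((N ℕ.* (k ℕ.* 2)) / 2)     ∎
    where
    exponent : k ℕ.* N ≡ (N ℕ.* (k ℕ.* 2)) / 2
    exponent = ≡.trans (ℕ.*-comm k N) (≡.sym
      (≡.trans (≡.cong (_/ 2) (≡.sym (ℕ.*-assoc N k 2))) (m*n/n≡m (N ℕ.* k) 2)))

∤2⇒odd : ∀ m → 2 ∤ m → ∃ λ k → m ≡ suc (k ℕ.* 2)
∤2⇒odd zero          2∤m = contradiction (divides 0 ≡.refl) 2∤m
∤2⇒odd (suc zero)    2∤m = 0 , ≡.refl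
∤2⇒odd (suc (suc m)) 2∤m with ∤2⇒odd m (λ { (divides k ≡.refl) → 2∤m (divides (suc k) ≡.refl) })
... | k , ≡.refl = suc k , ≡.refl

theorem2p4 : ∀ {c ℓ} (R : CommutativeRing c ℓ) →
    let open CommutativeRing R in
    let open Matrices R in
    (N m : ℕ) → N ≥ 2 → m ≥ 1 →
    (x : Fin N → Fin N → Vector Carrier m) →
    (2 ∣ m → det (blockD x) ≈ (- 1#) ^ ((N ℕ.* m) / 2) * product (λ i → det (X x i)))
    × (2 ∤ m → det (blockD x) ≈ (- 1#) ^ ((N ℕ.* (m ∸ 1)) / 2) * product (λ i → det (X x i)))
theorem2p4 R N m _ _ x = even , odd
  where
  open CommutativeRing R
  open Matrices R
  open Determinants R

  even : 2 ∣ m → det (blockD x) ≈ (- 1#) ^ ((N ℕ.* m) / 2) * product (λ i → det (X x i))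
  even (divides k ≡.refl) = trans (det-blockD N m x) (*-congʳ (sign-power N k (det-antitriangle-even k)))

  odd : 2 ∤ m → det (blockD x) ≈ (- 1#) ^ ((N ℕ.* (m ∸ 1)) / 2) * product (λ i → det (X x i))
  odd 2∤m with ∤2⇒odd m 2∤m
  -- Here `m` is `suc (k * 2)`, and `m ∸ 1` reduces to `k * 2`.
  ... | k , ≡.refl = trans (det-blockD N m x) (*-congʳ (sign-power N k (det-antitriangle-odd k)))
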